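{- Let $(\mathcal M_*,\mathcal M_{\le\omega})$ be a Büchi abstraction (with maps $\alpha_*,\gamma_*,\alpha_{\le\omega},\gamma_{\le\omega}$) that is faithful with respect to a language $\mathfrak A\subseteq\Sigma^{\le\omega}$, i.e. $\gamma_{\le\omega}(\alpha_{\le\omega}(\mathfrak A))=\mathfrak A$. Given a Büchi method typing $M_{\mathfrak A}:\mathit{Sig}\to\mathcal M_*\langle\mathit{Reg}\rangle\times\mathcal M_*\langle\mathit{Sig}\rangle$, one can directly compute an assignment $\eta_{\mathfrak A}:\mathit{Sig}\to\mathcal M_{\le\omega}$ that abstracts the infinitary effect typing $\eta_\gamma:\mathit{Sig}\to\mathcal P(\Sigma^{\le\omega})$ for the concretized method typing $M_{\mathfrak A}^\gamma$; that is, for all $\delta\in\mathit{Sig}$, $$\eta_{\mathfrak A}(\delta)=\alpha_{\le\omega}(\eta_\gamma(\delta)),$$ where $\eta_\gamma$ is the greatest solution in $\mathcal P(\Sigma^{\le\omega})$ of the equation system $\{\delta=\gamma(\mathcal S_\delta)\mid\delta\in\mathit{Sig}\}$ and $\mathcal S_\delta$ is the call expression (second component) of $M_{\mathfrak A}(\delta)$.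
   Context: WORDS. $\Sigma$ is a finite alphabet, $\Sigma^*$ the finite words ($\varepsilon$ the empty word), $\Sigma^{\le\omega}$ the finite and infinite words; $U\cdot V=\{uv\mid u\in U,v\in V\}$ for $U\subseteq\Sigma^*$ and $V\subseteq\Sigma^*$ or $V\subseteq\Sigma^{\le\omega}$; $U^\omega=\{u_1u_2\cdots\mid u_i\in U\}\subseteq\Sigma^{\le\omega}$. $\mathcal P$ is powerset. SIGNATURES. For a Featherweight Java program with classes $\mathit{Cls}$, methods $\mathit{Mtd}$ and finitely many object-creation labels $\ell$, the regions are $\mathit{Reg}\ni r::=\mathtt{Null}\mid\mathtt{CreatedAt}(\ell)\mid\mathtt{Unknown}$. A method signature is a tuple $(C,r,m,\bar s)$ of a class $C$, a region $r$, a method $m$ of $C$, and a list $\bar s$ of regions, one per argument of $m$; $\mathit{Sig}\subseteq\mathit{Cls}\times\mathit{Reg}\times\mathit{Mtd}\times\mathit{Reg}^*$ is the (finite) set of method signatures. BÜCHI ABSTRACTION. A Büchi algebra is a pair of join-semilattices $(\mathcal M_*,\mathcal M_{\le\omega})$ (order $\sqsubseteq$, join $\sqcup$) with monotone operations $\cdot:\mathcal M_*\times\mathcal M_*\to\mathcal M_*$, $\cdot:\mathcal M_*\times\mathcal M_{\le\omega}\to\mathcal M_{\le\omega}$, $(-)^\omega:\mathcal M_*\to\mathcal M_{\le\omega}$, with $\mathcal A\cdot(\mathcal B\cdot\mathcal U)=(\mathcal A\cdot\mathcal B)\cdot\mathcal U$ for $\mathcal A,\mathcal B\in\mathcal M_*$,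 $\mathcal U\in\mathcal M_*\cup\mathcal M_{\le\omega}$. A Galois insertion between partial orders $A$ and $C$ consists of monotone $\alpha:C\to A$, $\gamma:A\to C$ with $\alpha(\gamma(a))=a$ and $\gamma(\alpha(c))\sqsupseteq c$. A Büchi abstraction is a finite Büchi algebra with Galois insertions $(\alpha_*,\gamma_*)$ between $\mathcal M_*$ and $\mathcal P(\Sigma^*)$ and $(\alpha_{\le\omega},\gamma_{\le\omega})$ between $\mathcal M_{\le\omega}$ and $\mathcal P(\Sigma^{\le\omega})$ such that $\alpha_*(A\cdot B)=\alpha_*(A)\cdot\alpha_*(B)$, $\alpha_{\le\omega}(A\cdot V)=\alpha_*(A)\cdot\alpha_{\le\omega}(V)$, $\alpha_{\le\omega}(A^\omega)=\alpha_*(A)^\omega$ for all $A,B\subseteq\Sigma^*$, $V\subseteq\Sigma^{\le\omega}$. EXPRESSIONS. For a set $K$, $\mathcal P(\Sigma^*)\langle K\rangle$ and $\mathcal M_*\langle K\rangle$ are the sets of finite partial functions from $K$ to $\mathcal P(\Sigma^*)$, resp. $\mathcal M_*$ (undefined entries treated as the empty set, resp. the least element). Elements of $\mathcal P(\Sigma^*)\langle\mathit{Sig}\rangle$ and $\mathcal M_*\langle\mathit{Sig}\rangle$ are call expressions, written $\bigcup_i U_i\cdot\delta_i$, resp. $\bigsqcup_i\mathcal A_i\cdot\delta_i$. For $\mathcal T\in\mathcal M_*\langle K\rangle$, $\gamma(\mathcal T)\in\mathcal P(\Sigma^*)\langle K\rangle$ is given by $\gamma(\mathcal T)(x)=\gamma_*(\mathcal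 T(x))$ for $x\in\mathrm{dom}(\mathcal T)$. $M_{\mathfrak A}^\gamma(\delta)=(\gamma(\mathcal T),\gamma(\mathcal S))$ if $M_{\mathfrak A}(\delta)=(\mathcal T,\mathcal S)$. For $S=\bigcup_iU_i\cdot\delta_i$ and $\eta:\mathit{Sig}\to\mathcal P(\Sigma^{\le\omega})$ put $S(\eta)=\bigcup_iU_i\cdot\eta(\delta_i)$. INFINITARY EFFECT TYPING. For a method typing $M:\mathit{Sig}\to\mathcal P(\Sigma^*)\langle\mathit{Reg}\rangle\times\mathcal P(\Sigma^*)\langle\mathit{Sig}\rangle$ with second components $S_\delta$, the infinitary effect typing for $M$ is the greatest (pointwise inclusion) $\eta:\mathit{Sig}\to\mathcal P(\Sigma^{\le\omega})$ with $\eta(\delta)=S_\delta(\eta)$ for all $\delta\in\mathit{Sig}$. A Büchi method typing is a map $M_{\mathfrak A}$ of the type given in the claim that is monotone in the class: $M_{\mathfrak A}(C,r,m,\bar s)\sqsubseteq M_{\mathfrak A}(D,r,m,\bar s)$ (componentwise, pointwise) whenever $C$ is a (reflexive, transitive) subclass of $D$ and $m$ is a method of $D$. -}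

module Defs where

open import Level using (0ℓ; _⊔_) renaming (suc to lsuc)
open import Data.Fin.Base using (Fin)
open import Data.List.Base using (List; []; _∷_; _++_; concat; applyUpTo; length)
open import Data.Maybe.Base as Maybe using (Maybe; just; fromMaybe)
open import Data.Nat.Base using (ℕ; zero; suc)
open import Data.Product.Base using (∃; _×_; _,_; proj₁; proj₂)
open import Function.Bundles using (Inverse)
open import Relation.Binary.Bundles using (Setoid; Poset)
open import Relation.Binary.Construct.Closure.ReflexiveTransitive using (Star)
open import Relation.Binary.Definitions using (Monotonic₁; Monotonic₂)
open import Relation.Binary.Lattice.Bundles using (BoundedJoinSemilattice)
open import Relation.Binary.PropositionalEquality as ≡ using (_≡_; refl; cong)
open import Relation.Unary using (Pred; ∅; _⊆_)
open import Relation.Unary.Relation.Binary.Subset using (⊆-poset)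

------------------------------------------------------------------------
-- Finiteness

IsFinite : Setoid 0ℓ 0ℓ → Set
IsFinite S = ∃ λ n → Inverse S (≡.setoid (Fin n))

IsFiniteSet : Set → Set
IsFiniteSet A = IsFinite (≡.setoid A)

------------------------------------------------------------------------
-- Words

data Word≤ω (A : Set) : Set where
  fin : List A → Word≤ω A
  inf : (ℕ → A) → Word≤ω A

module _ {A : Set} where

  infix 4 _≈ʷ_ _≼_
  infixr 5 _++ᶠ_ _++ʷ_

  -- Infinite words are functions, hence compared pointwise.
  data _≈ʷ_ : Word≤ω A → Word≤ω A → Set where
    fin : ∀ {u v} → u ≡ v → fin u ≈ʷ fin v
    inf : ∀ {f g} → (∀ n → f n ≡ g n) → inf f ≈ʷ inf g

  ≈ʷ-refl : ∀ {w} → w ≈ʷ w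
  ≈ʷ-refl {fin u} = fin refl
  ≈ʷ-refl {inf f} = inf λ _ → refl

  ≈ʷ-sym : ∀ {w x} → w ≈ʷ x → x ≈ʷ w
  ≈ʷ-sym (fin p) = fin (≡.sym p)
  ≈ʷ-sym (inf p) = inf λ n → ≡.sym (p n)

  ≈ʷ-trans : ∀ {w x y} → w ≈ʷ x → x ≈ʷ y → w ≈ʷ y
  ≈ʷ-trans (fin p) (fin q) = fin (≡.trans p q)
  ≈ʷ-trans (inf p) (inf q) = inf λ n → ≡.trans (p n) (q n)

  _++ᶠ_ : List A → (ℕ → A) → ℕ → A
  ([]      ++ᶠ f) n       = f n
  ((a ∷ u) ++ᶠ f) zero    = a
  ((a ∷ u) ++ᶠ f) (suc n) = (u ++ᶠ f) n

  _++ʷ_ : List A → Word≤ω A → Word≤ω A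
  u ++ʷ fin v = fin (u ++ v)
  u ++ʷ inf f = inf (u ++ᶠ f)

  _≼_ : List A → Word≤ω A → Set
  u ≼ w = ∃ λ x → w ≈ʷ u ++ʷ x

  -- w = u₀u₁u₂⋯ : w is the limit of the finite products u₀⋯uₙ₋₁.  It is a
  -- finite word exactly when all but finitely many uᵢ are empty.
  _IsProductOf_ : Word≤ω A → (ℕ → List A) → Set
  w IsProductOf u =
    (∀ n → concat (applyUpTo u n) ≼ w) ×
    (∀ v → v ≼ w → ∃ λ n → v ≼ fin (concat (applyUpTo u n)))

------------------------------------------------------------------------
-- Languages

Lang : Set → Set₁
Lang A = Pred (List A) 0ℓ

-- Subsets of Σ^≤ω are predicates that do not distinguish equal words.
record Lang≤ω (A : Set) : Set₁ where
  field
    mem  : Pred (Word≤ω A) 0ℓ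
    resp : ∀ {w x} → w ≈ʷ x → mem w → mem x

open Lang≤ω public

module _ {A : Set} where

  infix  4 _∈ω_ _⊆ω_ _≐ω_
  infixr 7 _·ᴸ_ _·ω_

  _∈ω_ : Word≤ω A → Lang≤ω A → Set
  w ∈ω V = mem V w

  _⊆ω_ _≐ω_ : Lang≤ω A → Lang≤ω A → Set
  V ⊆ω W = mem V ⊆ mem W
  V ≐ω W = (V ⊆ω W) × (W ⊆ω V)

  _·ᴸ_ : Lang A → Lang A → Lang A
  (U ·ᴸ V) w = ∃ λ u → ∃ λ v → U u × V v × w ≡ u ++ v

  _·ω_ : Lang A → Lang≤ω A → Lang≤ω A
  mem  (U ·ω V) w = ∃ λ u → ∃ λ v → U u × v ∈ω V × w ≈ʷ u ++ʷ v
  resp (U ·ω V) p (u , v , u∈U , v∈V , eq) =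
    u , v , u∈U , v∈V , ≈ʷ-trans (≈ʷ-sym p) eq

  _^ωᴸ : Lang A → Lang≤ω A
  mem  (U ^ωᴸ) w = ∃ λ u → (∀ i → U (u i)) × w IsProductOf u
  resp (U ^ωᴸ) p (u , u∈U , below , least) =
    u , u∈U
    , (λ n → proj₁ (below n) , ≈ʷ-trans (≈ʷ-sym p) (proj₂ (below n)))
    , (λ v (x , eq) → least v (x , ≈ʷ-trans p eq))

  ⋃ω : {I : Set} → (I → Lang≤ω A) → Lang≤ω A
  mem  (⋃ω V) w = ∃ λ i → w ∈ω V i
  resp (⋃ω V) p (i , w∈) = i , resp (V i) p w∈

Lang-poset : Set → Poset (lsuc 0ℓ) 0ℓ 0ℓ
Lang-poset A = ⊆-poset (List A) 0ℓ

Lang≤ω-poset : Set → Poset (lsuc 0ℓ) 0ℓ 0ℓ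
Lang≤ω-poset A = record
  { Carrier = Lang≤ω A
  ; _≈_ = _≐ω_
  ; _≤_ = _⊆ω_
  ; isPartialOrder = record
    { isPreorder = record
      { isEquivalence = record
        { refl  = (λ p → p) , (λ p → p)
        ; sym   = λ (f , g) → g , f
        ; trans = λ (f , g) (h , k) → (λ p → h (f p)) , (λ p → g (k p))
        }
      ; reflexive = proj₁
      ; trans = λ f g p → g (f p)
      }
    ; antisym = _,_
    }
  }

------------------------------------------------------------------------
-- Büchi algebras and abstractions

-- The semilattices are bounded below because undefined entries of
-- expressions are read as the least element; in a Büchi abstraction the
-- least elements are the abstractions of the empty languages.
record BüchiAlgebra : Set₁ where
  field
    M*  : BoundedJoinSemilattice 0ℓ 0ℓ 0ℓ
    M≤ω : BoundedJoinSemilattice 0ℓ 0ℓ 0ℓ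

  module M*  = BoundedJoinSemilattice M*
  module M≤ω = BoundedJoinSemilattice M≤ω

  infixr 7 _·_ _⊙_
  infix  8 _^ω
  field
    _·_ : M*.Carrier → M*.Carrier → M*.Carrier
    _⊙_ : M*.Carrier → M≤ω.Carrier → M≤ω.Carrier
    _^ω : M*.Carrier → M≤ω.Carrier

    ·-mono  : Monotonic₂ M*._≤_ M*._≤_ M*._≤_ _·_
    ⊙-mono  : Monotonic₂ M*._≤_ M≤ω._≤_ M≤ω._≤_ _⊙_
    ^ω-mono : Monotonic₁ M*._≤_ M≤ω._≤_ _^ω

    ·-assoc : ∀ a b c → (a · (b · c)) M*.≈ ((a · b) · c)
    ⊙-assoc : ∀ a b u → (a ⊙ (b ⊙ u)) M≤ω.≈ ((a · b) ⊙ u)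

record FiniteBüchiAlgebra : Set₁ where
  field
    algebra : BüchiAlgebra
  open BüchiAlgebra algebra public
  field
    M*-finite  : IsFinite (Poset.Eq.setoid M*.poset)
    M≤ω-finite : IsFinite (Poset.Eq.setoid M≤ω.poset)

record GaloisInsertion {a₁ a₂ a₃ c₁ c₂ c₃}
    (A : Poset a₁ a₂ a₃) (C : Poset c₁ c₂ c₃) :
    Set (a₁ ⊔ a₂ ⊔ a₃ ⊔ c₁ ⊔ c₂ ⊔ c₃) where
  private
    module A = Poset A
    module C = Poset C
  field
    α      : C.Carrier → A.Carrier
    γ      : A.Carrier → C.Carrier
    α-mono : Monotonic₁ C._≤_ A._≤_ α
    γ-mono : Monotonic₁ A._≤_ C._≤_ γ
    α∘γ    : ∀ a → α (γ a) A.≈ a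
    γ∘α    : ∀ c → c C.≤ γ (α c)

-- A Büchi abstraction over the alphabet A with underlying finite algebra B.
record BüchiAbstraction (A : Set) (B : FiniteBüchiAlgebra) : Set₁ where
  open FiniteBüchiAlgebra B
  field
    insertion*  : GaloisInsertion M*.poset  (Lang-poset A)
    insertion≤ω : GaloisInsertion M≤ω.poset (Lang≤ω-poset A)

  open GaloisInsertion insertion* public using () renaming
    (α to α*; γ to γ*; α-mono to α*-mono; γ-mono to γ*-mono;
     α∘γ to α*∘γ*; γ∘α to γ*∘α*)
  open GaloisInsertion insertion≤ω public using () renaming
    (α to α≤ω; γ to γ≤ω; α-mono to α≤ω-mono; γ-mono to γ≤ω-mono;
     α∘γ to α≤ω∘γ≤ω; γ∘α to γ≤ω∘α≤ω)

  field
    α-· : ∀ U V → α* (U ·ᴸ V) M*.≈ (α* U · α* V)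
    α-⊙ : ∀ U V → α≤ω (U ·ω V) M≤ω.≈ (α* U ⊙ α≤ω V)
    α-ω : ∀ U → α≤ω (U ^ωᴸ) M≤ω.≈ (α* U ^ω)

  Faithful : Lang≤ω A → Set
  Faithful 𝔄 = γ≤ω (α≤ω 𝔄) ≐ω 𝔄

------------------------------------------------------------------------
-- Programs and method signatures

data Region (Label : Set) : Set where
  Null      : Region Label
  CreatedAt : Label → Region Label
  Unknown   : Region Label

-- The part of a Featherweight Java program on which signatures depend.
record Program : Set₁ where
  field
    Cls Mtd Label : Set
    Cls-finite    : IsFiniteSet Cls
    Mtd-finite    : IsFiniteSet Mtd
    Label-finite  : IsFiniteSet Label

    super : Cls → Maybe Cls

    -- arity C m ≡ just n: m is a (declared or inherited) method of C, and
    -- it has n arguments.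
    arity : Cls → Mtd → Maybe ℕ
    arity-inherited : ∀ {C D m n} →
      super C ≡ just D → arity D m ≡ just n → arity C m ≡ just n

  infix 4 _<:_
  _<:_ : Cls → Cls → Set
  _<:_ = Star (λ C D → super C ≡ just D)

  Reg : Set
  Reg = Region Label

  record Sig : Set where
    constructor sig
    field
      cls  : Cls
      reg  : Reg
      mtd  : Mtd
      args : List Reg
      .well-formed : arity cls mtd ≡ just (length args)

------------------------------------------------------------------------
-- Expressions and method typings

-- Finite partial functions.  Only the finite sets Reg and Sig are used
-- for K, so finiteness of the domain is automatic.
_⟨_⟩ : ∀ {ℓ} → Set ℓ → Set → Set ℓ
V ⟨ K ⟩ = K → Maybe V

module _ (P : Program) where
  open Program P

  MethodTyping : Set → Set₁
  MethodTyping A = Sig → (Lang A ⟨ Reg ⟩) × (Lang A ⟨ Sig ⟩)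

  module _ (B : FiniteBüchiAlgebra) where
    open FiniteBüchiAlgebra B

    _⊑_ : {K : Set} → M*.Carrier ⟨ K ⟩ → M*.Carrier ⟨ K ⟩ → Set
    S ⊑ T = ∀ k → fromMaybe M*.⊥ (S k) M*.≤ fromMaybe M*.⊥ (T k)

    -- In `monotone', that m is a method of D is part of (D, r, m, s) being
    -- a signature.
    record BüchiMethodTyping : Set where
      field
        typing : Sig → (M*.Carrier ⟨ Reg ⟩) × (M*.Carrier ⟨ Sig ⟩)
        monotone : ∀ {C D r m s} .{p : arity C m ≡ just (length s)}
          .{q : arity D m ≡ just (length s)} → C <: D →
          (proj₁ (typing (sig C r m s p)) ⊑ proj₁ (typing (sig D r m s q))) ×
          (proj₂ (typing (sig C r m s p)) ⊑ proj₂ (typing (sig D r m s q)))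

  concretize : ∀ {A B} → BüchiAbstraction A B →
    BüchiMethodTyping B → MethodTyping A
  concretize 𝓜 M δ =
    (λ r → Maybe.map γ* (proj₁ (typing δ) r)) ,
    (λ ε → Maybe.map γ* (proj₂ (typing δ) ε))
    where
    open BüchiAbstraction 𝓜
    open BüchiMethodTyping M

  module _ {A : Set} where

    -- S(η)
    _[_] : Lang A ⟨ Sig ⟩ → (Sig → Lang≤ω A) → Lang≤ω A
    S [ η ] = ⋃ω λ δ → fromMaybe ∅ (S δ) ·ω η δ

    IsSolution : MethodTyping A → (Sig → Lang≤ω A) → Set
    IsSolution M η = ∀ δ → η δ ≐ω (proj₂ (M δ) [ η ])

    IsInfinitaryEffectTyping : MethodTyping A → (Sig → Lang≤ω A) → Set₁
    IsInfinitaryEffectTyping M η =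
      IsSolution M η × (∀ η′ → IsSolution M η′ → ∀ δ → η′ δ ⊆ω η δ)

    -- The greatest solution exists: it consists of the words that can be
    -- unfolded forever along the equations.
    record Unfolding (M : MethodTyping A) (δ : Sig) (w : Word≤ω A) : Set where
      field
        sigs   : ℕ → Sig
        words  : ℕ → Word≤ω A
        heads  : ℕ → List A
        start  : sigs 0 ≡ δ
        start′ : w ≈ʷ words 0
        step   : ∀ n → fromMaybe ∅ (proj₂ (M (sigs n)) (sigs (suc n))) (heads n)
        step′  : ∀ n → words n ≈ʷ heads n ++ʷ words (suc n)

    infinitaryEffectTyping : MethodTyping A → Sig → Lang≤ω A
    mem  (infinitaryEffectTyping M δ) = Unfolding M δ
    resp (infinitaryEffectTyping M δ) p t =
      record { Unfolding t; start′ = ≈ʷ-trans (≈ʷ-sym p) (Unfolding.start′ t) }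

    private
      ++ᶠ-cong : ∀ u {f g : ℕ → A} → (∀ n → f n ≡ g n) →
        ∀ n → (u ++ᶠ f) n ≡ (u ++ᶠ g) n
      ++ᶠ-cong []      p n       = p n
      ++ᶠ-cong (a ∷ u) p zero    = refl
      ++ᶠ-cong (a ∷ u) p (suc n) = ++ᶠ-cong u p n

      ++ʷ-cong : ∀ u {w x : Word≤ω A} → w ≈ʷ x → u ++ʷ w ≈ʷ u ++ʷ x
      ++ʷ-cong u (fin p) = fin (cong (u ++_) p)
      ++ʷ-cong u (inf p) = inf (++ᶠ-cong u p)

      cons : ∀ {ℓ} {X : Set ℓ} → X → (ℕ → X) → ℕ → X
      cons x f zero    = x
      cons x f (suc n) = f n

    infinitaryEffectTyping-correct : ∀ M →
      IsInfinitaryEffectTyping M (infinitaryEffectTyping M)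
    infinitaryEffectTyping-correct M = (λ δ → unfold δ , fold δ) , greatest
      where
      η = infinitaryEffectTyping M

      unfold : ∀ δ → η δ ⊆ω (proj₂ (M δ) [ η ])
      unfold δ t = sigs 1 , heads 0 , words 1
        , ≡.subst (λ ε → fromMaybe ∅ (proj₂ (M ε) (sigs 1)) (heads 0))
            start (step 0)
        , record
          { sigs = λ n → sigs (suc n) ; words = λ n → words (suc n)
          ; heads = λ n → heads (suc n) ; start = refl ; start′ = ≈ʷ-refl
          ; step = λ n → step (suc n) ; step′ = λ n → step′ (suc n) }
        , ≈ʷ-trans start′ (step′ 0)
        where open Unfolding t

      fold : ∀ δ → (proj₂ (M δ) [ η ]) ⊆ω η δ
      fold δ {w} (ε , u , v , u∈ , t , eq) = record
        { sigs = cons δ sigs ; words = cons w words ; heads = cons u heads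
        ; start = refl ; start′ = ≈ʷ-refl
        ; step  = λ { zero → ≡.subst (λ ε → fromMaybe ∅ (proj₂ (M δ) ε) u)
                               (≡.sym start) u∈
                    ; (suc n) → step n }
        ; step′ = λ { zero → ≈ʷ-trans eq (++ʷ-cong u start′)
                    ; (suc n) → step′ n } }
        where open Unfolding t

      greatest : ∀ η′ → IsSolution M η′ → ∀ δ → η′ δ ⊆ω η δ
      greatest η′ sol δ {w} w∈ = record
        { sigs  = λ n → proj₁ (run n)
        ; words = λ n → proj₁ (proj₂ (run n))
        ; heads = λ n → proj₁ (proj₂ (split (run n)))
        ; start = refl ; start′ = ≈ʷ-refl
        ; step  = λ n → proj₁ (proj₂ (proj₂ (proj₂ (split (run n)))))
        ; step′ = λ n → proj₂ (proj₂ (proj₂ (proj₂ (proj₂ (split (run n))))))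
        }
        where
        State = ∃ λ δ → ∃ λ w → w ∈ω η′ δ

        split : ((δ , w , _) : State) → w ∈ω (proj₂ (M δ) [ η′ ])
        split (δ , w , w∈) = proj₁ (sol δ) w∈

        run : ℕ → State
        run zero    = δ , w , w∈
        run (suc n) =
          let (ε , u , v , _ , v∈ , _) = split (run n) in ε , v , v∈

{-# OPTIONS --safe #-}
module Submission where

-- Write U(δ,ε) for the language with which the call expression of δ calls ε,
-- view it as the label of an edge from δ to ε, and let W(δ,ε) be the language
-- of all words read along nonempty paths from δ to ε.  Unfolding the
-- equations forever traces an infinite path.  As there are finitely many
-- signatures, some ε recurs on it, so the word read splits into a word of
-- W(δ,ε) followed by infinitely many laps around ε.  If the empty word is not
-- in W(ε,ε), every lap is nonempty and the rest of the word lies in W(ε,ε)^ω;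
-- if it is, then ε unfolds to itself without consuming anything and every
-- word is allowed.  Hence (effectTyping≐Lasso) the greatest solution is
--
--   η(δ) = ⋃_ε W(δ,ε) · L(ε),
--
-- where L(ε) is Σ^≤ω if W(ε,ε) contains the empty word and W(ε,ε)^ω otherwise.
--
-- This formula can be evaluated abstractly.  The maps α preserve joins, being
-- left adjoints, and products and ω-powers by assumption.  The abstraction of
-- W(δ,ε) is therefore an entry of the transitive closure, over M*, of the
-- matrix of call expressions; finiteness lets the closure be computed by
-- iteration from the least element (α-Walk).
--
-- Deciding whether the empty word is in W(ε,ε) needs more care: it cannot be
-- read off from α(W(ε,ε)), because γ(α(W(ε,ε))) may contain the empty word when
-- W(ε,ε) does not.  However, mapping a language to the truth value of "it
-- contains the empty word" is itself a Galois insertion preserving products,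
-- with the two-element lattice in place of M*, so α-Walk applies to it
-- as well.  Only the nullability of the edge labels γ(a) is left, and
-- that is visible in the algebra: the empty word is in γ(a) exactly when
-- b ≤ a · b for all b (ε∈γ⇔inflationary).

open import Defs
open import Level using (0ℓ)
open import Axiom.ExcludedMiddle using (ExcludedMiddle)
open import Data.Product.Base using (Σ-syntax)

open import Data.Bool.Base as Bool
  using (Bool; true; false; _∧_; _∨_; T; if_then_else_; b≤b; f≤t)
import Data.Bool.Properties as Bool
open import Data.Empty using (⊥-elim)
open import Data.Fin.Base as Fin using (Fin; toℕ; funToFin; finToFun)
import Data.Fin.Properties as Fin
open import Data.List.Base
  using (List; []; _∷_; [_]; _++_; map; mapMaybe; foldr; lookup; length;
         tabulate; concat; concatMap; applyUpTo; cartesianProduct; cartesianProductWith)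
open import Data.List.Membership.Propositional using (_∈_)
open import Data.List.Membership.Propositional.Properties
  using (∈-map⁺; ∈-concatMap⁺; ∈-cartesianProduct⁺; ∈-cartesianProductWith⁺)
import Data.List.Properties as List
import Data.List.Relation.Unary.All as All
open import Data.List.Relation.Unary.Any as Any using (Any; here; there)
open import Data.List.Relation.Unary.Any.Properties
  using (tabulate⁺; mapMaybe⁺; lookup-index)
open import Data.Maybe.Base as Maybe using (Maybe; just; nothing; fromMaybe)
import Data.Maybe.Properties as Maybe
import Data.Maybe.Relation.Unary.Any as MAny
open import Data.Nat.Base as ℕ using (ℕ; zero; suc; z≤n; s≤s; _≤‴_; ≤‴-refl; ≤‴-step)
import Data.Nat.Properties as ℕ
open import Data.Product.Base using (∃; _×_; _,_; proj₁; proj₂)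
open import Data.Sum.Base using (_⊎_; inj₁; inj₂)
open import Function.Base using (id; _∘_; case_of_)
open import Function.Bundles using (Inverse; module Injection; module Equivalence)
open import Function.Properties.Inverse using (Inverse⇒Injection; ↔-sym)
open import Relation.Binary.Bundles using (Setoid; Poset)
open import Relation.Binary.Definitions using (Decidable; Monotonic₂)
open import Relation.Binary.Lattice.Bundles using (BoundedJoinSemilattice)
import Relation.Binary.Lattice.Properties.JoinSemilattice as JoinProperties
open import Relation.Binary.PropositionalEquality as ≡
  using (_≡_; _≢_; refl; cong; subst; subst₂)
open import Relation.Nullary.Decidable
  using (Dec; yes; no; ⌊_⌋; toWitness; fromWitness; recompute; via-injection; map′;
         decidable-stable)
open import Relation.Nullary.Negation using (¬_)
open import Relation.Unary using (∅)

------------------------------------------------------------------------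
-- Finite sets

module _ {S : Setoid 0ℓ 0ℓ} (finite : IsFinite S) where
  open Setoid S
  open Inverse (proj₂ finite)

  elements : List Carrier
  elements = tabulate from

  elements-complete : ∀ x → Any (x ≈_) elements
  elements-complete x = tabulate⁺ (to x) (sym (strictlyInverseʳ x))

  finite⇒decidable : Decidable _≈_
  finite⇒decidable = via-injection (Inverse⇒Injection (proj₂ finite)) Fin._≟_

-- A list of all elements of I, possibly with repetitions.
record Enumeration (I : Set) : Set where
  field
    list     : List I
    complete : ∀ i → i ∈ list

listsOfLength : {X : Set} → List X → ℕ → List (List X)
listsOfLength xs zero    = [ [] ]
listsOfLength xs (suc n) = cartesianProductWith _∷_ xs (listsOfLength xs n)

∈-listsOfLength : {X : Set} (xs : List X) → (∀ x → x ∈ xs) →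
  ∀ ys → ys ∈ listsOfLength xs (length ys)
∈-listsOfLength xs all []       = here refl
∈-listsOfLength xs all (y ∷ ys) =
  ∈-cartesianProductWith⁺ _∷_ (all y) (∈-listsOfLength xs all ys)

module _ (P : Program) where
  open Program P

  private
    regions : List Reg
    regions = Null ∷ Unknown ∷ map CreatedAt (elements Label-finite)

    ∈-regions : ∀ r → r ∈ regions
    ∈-regions Null          = here refl
    ∈-regions Unknown       = there (here refl)
    ∈-regions (CreatedAt ℓ) =
      there (there (∈-map⁺ CreatedAt (elements-complete Label-finite ℓ)))

    wellFormed? : ∀ C m (s : List Reg) → Dec (arity C m ≡ just (length s))
    wellFormed? C m s = Maybe.≡-dec ℕ._≟_ (arity C m) (just (length s))

    -- Candidates for the class, region and method of a signature.
    candidates : List (Cls × Reg × Mtd)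
    candidates = cartesianProduct (elements Cls-finite)
      (cartesianProduct regions (elements Mtd-finite))

    ∈-candidates : ∀ C r m → (C , r , m) ∈ candidates
    ∈-candidates C r m = ∈-cartesianProduct⁺ (elements-complete Cls-finite C)
      (∈-cartesianProduct⁺ (∈-regions r) (elements-complete Mtd-finite m))

    withArgs : Cls × Reg × Mtd → List Reg → Maybe Sig
    withArgs (C , r , m) s with wellFormed? C m s
    ... | yes p = just (sig C r m s p)
    ... | no  _ = nothing

    withArgs-just : ∀ C r m s .(p : arity C m ≡ just (length s)) →
      withArgs (C , r , m) s ≡ just (sig C r m s p)
    withArgs-just C r m s p with wellFormed? C m s
    ... | yes _ = refl
    ... | no ¬p = ⊥-elim (¬p (recompute (wellFormed? C m s) p))

    sigsOf : Cls × Reg × Mtd → List Sig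
    sigsOf x@(C , _ , m) =
      -- The default 0 is harmless: withArgs rejects every argument list if m
      -- is not a method of C.
      mapMaybe (withArgs x) (listsOfLength regions (fromMaybe 0 (arity C m)))

    ∈-sigsOf : ∀ C r m s .(p : arity C m ≡ just (length s)) →
      sig C r m s p ∈ sigsOf (C , r , m)
    ∈-sigsOf C r m s p = mapMaybe⁺ (withArgs (C , r , m)) _ (found s∈)
      where
      s∈ : s ∈ listsOfLength regions (fromMaybe 0 (arity C m))
      s∈ = subst (λ n → s ∈ listsOfLength regions (fromMaybe 0 n))
             (≡.sym (recompute (wellFormed? C m s) p))
             (∈-listsOfLength regions ∈-regions s)

      found : ∀ {ss} → s ∈ ss →
        Any (MAny.Any (sig C r m s p ≡_)) (map (withArgs (C , r , m)) ss)
      found (here refl) = here (subst (MAny.Any (sig C r m s p ≡_))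
        (≡.sym (withArgs-just C r m s p)) (MAny.just refl))
      found (there q)   = there (found q)

  signatures : Enumeration Sig
  signatures = record
    { list     = concatMap sigsOf candidates
    ; complete = λ { (sig C r m s p) →
        ∈-concatMap⁺ sigsOf (Any.map (λ { refl → ∈-sigsOf C r m s p })
          (∈-candidates C r m)) } }

------------------------------------------------------------------------
-- Finite joins

module FiniteJoin (S : BoundedJoinSemilattice 0ℓ 0ℓ 0ℓ) where
  private module S = BoundedJoinSemilattice S
  open S using (Carrier; _≤_)

  ⋁ : {I : Set} → List I → (I → Carrier) → Carrier
  ⋁ is x = foldr (λ i y → x i S.∨ y) S.⊥ is

  ≤⋁ : ∀ {I : Set} {is : List I} {x : I → Carrier} {y} →
    Any (λ i → y ≤ x i) is → y ≤ ⋁ is x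
  ≤⋁ (here y≤x)  = S.trans y≤x (S.x≤x∨y _ _)
  ≤⋁ (there any) = S.trans (≤⋁ any) (S.y≤x∨y _ _)

  ⋁-upper : ∀ {I : Set} {is : List I} {i} (x : I → Carrier) →
    i ∈ is → x i ≤ ⋁ is x
  ⋁-upper x i∈ = ≤⋁ (Any.map (λ { refl → S.refl }) i∈)

  ⋁-least : ∀ {I : Set} (is : List I) {x : I → Carrier} {y} →
    (∀ i → x i ≤ y) → ⋁ is x ≤ y
  ⋁-least []       x≤y = S.minimum _
  ⋁-least (i ∷ is) x≤y = S.∨-least (x≤y i) (⋁-least is x≤y)

  ⋁-mono : ∀ {I : Set} {is : List I} {x y : I → Carrier} →
    (∀ i → x i ≤ y i) → ⋁ is x ≤ ⋁ is y
  ⋁-mono {is = []}     x≤y = S.refl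
  ⋁-mono {is = i ∷ is} x≤y =
    JoinProperties.∨-monotonic S.joinSemilattice (x≤y i) (⋁-mono {is = is} x≤y)

  module _ (finite : IsFinite (Poset.Eq.setoid S.poset)) where

    _≤?_ : Decidable _≤_
    _≤?_ = JoinProperties.≈-dec⇒≤-dec S.joinSemilattice (finite⇒decidable finite)

    ⊤ : Carrier
    ⊤ = ⋁ (elements finite) id

    ≤⊤ : ∀ x → x ≤ ⊤
    ≤⊤ x = ≤⋁ (Any.map S.reflexive (elements-complete finite x))

------------------------------------------------------------------------
-- Transitive closure of a matrix over a finite algebra

-- A finite bounded join semilattice with a monotone multiplication, which
-- need be neither associative nor distributive.
record FiniteAlgebra : Set₁ where
  field
    semilattice : BoundedJoinSemilattice 0ℓ 0ℓ 0ℓ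
  open BoundedJoinSemilattice semilattice public
  field
    finite : IsFinite (Poset.Eq.setoid poset)
    _·_    : Carrier → Carrier → Carrier
    ·-mono : Monotonic₂ _≤_ _≤_ _≤_ _·_

module Closure {I : Set} (E : Enumeration I) (S : FiniteAlgebra)
    (a : I → I → FiniteAlgebra.Carrier S) where
  open FiniteAlgebra S using (Carrier; _≈_; _≤_; _·_; ·-mono; finite; semilattice)
  private module S = FiniteAlgebra S
  open FiniteJoin semilattice
  open Enumeration E renaming (list to is)

  -- The j-th column of the transitive closure is the least fixed point of
  -- step j.
  step : I → (I → Carrier) → I → Carrier
  step j x i = a i j S.∨ ⋁ is (λ k → a i k · x k)

  approx : I → ℕ → I → Carrier
  approx j zero    = λ _ → S.⊥
  approx j (suc n) = step j (approx j n)

  -- The number, up to ≈, of vectors indexed by the positions of is.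
  bound : ℕ
  bound = proj₁ finite ℕ.^ length is

  -- The transitive closure of a: the least matrix above a whose entries
  -- satisfy a i k · plus k j ≤ plus i j.
  plus : I → I → Carrier
  plus i j = approx j bound i

  private
    step-mono : ∀ j {x y} → (∀ i → x i ≤ y i) → ∀ i → step j x i ≤ step j y i
    step-mono j x≤y i = JoinProperties.∨-monotonic S.joinSemilattice S.refl
      (⋁-mono {is = is} (λ k → ·-mono S.refl (x≤y k)))

    ascending : ∀ j n i → approx j n i ≤ approx j (suc n) i
    ascending j zero    = λ _ → S.minimum _
    ascending j (suc n) = step-mono j (ascending j n)

    ascending* : ∀ j {m n} → m ≤‴ n → ∀ i → approx j m i ≤ approx j n i
    ascending* j ≤‴-refl      i = S.refl
    ascending* j {m} (≤‴-step le) i =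
      S.trans (ascending j m i) (ascending* j le i)

    Stable : I → ℕ → Set
    Stable j n = ∀ i → approx j (suc n) i ≤ approx j n i

    stable* : ∀ j {m n} → m ≤‴ n → Stable j m → Stable j n
    stable* j ≤‴-refl      st = st
    stable* j (≤‴-step le) st = stable* j le (step-mono j st)

    code : (I → Carrier) → Fin bound
    code x = funToFin (λ p → Inverse.to (proj₂ finite) (x (lookup is p)))

    code-injective : ∀ x y → code x ≡ code y → ∀ i → x i ≈ y i
    code-injective x y eq i =
      subst (λ k → x k ≈ y k) (≡.sym (lookup-index (complete i)))
        (Injection.injective (Inverse⇒Injection (proj₂ finite)) (begin
          to (x (lookup is p))    ≡⟨ Fin.finToFun-funToFin _ p ⟨
          finToFun (code x) p     ≡⟨ cong (λ c → finToFun c p) eq ⟩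
          finToFun (code y) p     ≡⟨ Fin.finToFun-funToFin _ p ⟩
          to (y (lookup is p))    ∎))
      where
      open ≡.≡-Reasoning
      open Inverse (proj₂ finite) using (to)
      p = Any.index (complete i)

    -- By the pigeonhole principle two of the first bound + 1 approximants
    -- agree, and an ascending chain is constant between equal members.
    stable : ∀ j → Stable j bound
    stable j with Fin.pigeonhole (ℕ.n<1+n bound) (code ∘ approx j ∘ toℕ)
    ... | m , n , m<n , eq =
      stable* j {toℕ m} (ℕ.≤⇒≤‴ (ℕ.≤-pred (Fin.toℕ<n m))) λ i →
        S.trans (ascending* j (ℕ.≤⇒≤‴ m<n) i)
          (S.reflexive (S.Eq.sym
            (code-injective (approx j (toℕ m)) (approx j (toℕ n)) eq i)))

  plus-base : ∀ i j → a i j ≤ plus i j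
  plus-base i j = S.trans (S.x≤x∨y _ _) (stable j i)

  plus-step : ∀ i k j → a i k · plus k j ≤ plus i j
  plus-step i k j =
    S.trans (⋁-upper (λ k → a i k · plus k j) (complete k))
      (S.trans (S.y≤x∨y _ _) (stable j i))

  plus-least : ∀ {x : I → I → Carrier} → (∀ i j → a i j ≤ x i j) →
    (∀ i k j → a i k · x k j ≤ x i j) → ∀ i j → plus i j ≤ x i j
  plus-least {x} base trans i j = go bound i
    where
    go : ∀ n i → approx j n i ≤ x i j
    go zero    i = S.minimum _
    go (suc n) i = S.∨-least (base i j)
      (⋁-least is λ k → S.trans (·-mono S.refl (go n k)) (trans i k j))

------------------------------------------------------------------------
-- Walks and their abstraction

-- Walk U i j consists of the words read along nonempty paths from i to j in the
-- graph whose edge from i to j carries the language U i j for all i and j.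
data Walk {A I : Set} (U : I → I → Lang A) (i : I) : I → Lang A where
  edge : ∀ {j u} → U i j u → Walk U i j u
  _∷_  : ∀ {k j u v} → U i k u → Walk U k j v → Walk U i j (u ++ v)

-- The maps of a Galois insertion form an adjunction.
module Adjunction {a₁ a₂ a₃ c₁ c₂ c₃} {A : Poset a₁ a₂ a₃} {C : Poset c₁ c₂ c₃}
    (G : GaloisInsertion A C) where
  private
    module A = Poset A
    module C = Poset C
  open GaloisInsertion G

  α-adjoint : ∀ {c a} → c C.≤ γ a → α c A.≤ a
  α-adjoint c≤γa = A.trans (α-mono c≤γa) (A.reflexive (α∘γ _))

  γ-adjoint : ∀ {c a} → α c A.≤ a → c C.≤ γ a
  γ-adjoint αc≤a = C.trans (γ∘α _) (γ-mono αc≤a)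

module _ {A I : Set} (E : Enumeration I) (S : FiniteAlgebra) where
  private module S = FiniteAlgebra S
  open S using (_≈_; _≤_; _·_)

  module _ (G : GaloisInsertion S.poset (Lang-poset A))
    (α-· : ∀ U V → GaloisInsertion.α G (U ·ᴸ V) ≈
                   (GaloisInsertion.α G U · GaloisInsertion.α G V)) where
    open GaloisInsertion G

    -- A Galois insertion that preserves products turns path languages into
    -- the transitive closure of the abstract labels.
    α-Walk : ∀ (U : I → I → Lang A) a → (∀ i j → α (U i j) ≈ a i j) →
      ∀ i j → α (Walk U i j) ≈ Closure.plus E S a i j
    α-Walk U a α-U i j = S.antisym (α-adjoint below) (plus-least base trans i j)
      where
      open Closure E S a
      open Adjunction G

      -- The concretized closure contains all edges and is closed under
      -- prepending one.
      below : ∀ {i j w} → Walk U i j w → γ (plus i j) w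
      below {i} {j} (edge u∈) =
        γ-adjoint (S.trans (S.reflexive (α-U i j)) (plus-base i j)) u∈
      below {i} {j} (_∷_ {k} {u = u} {v} u∈ v∈) =
        γ-adjoint (S.trans (S.reflexive (α-· (U i k) (γ (plus k j))))
          (S.trans (S.·-mono (S.reflexive (α-U i k)) (S.reflexive (α∘γ _)))
            (plus-step i k j)))
          (u , v , u∈ , below v∈ , refl)

      base : ∀ i j → a i j ≤ α (Walk U i j)
      base i j = S.trans (S.reflexive (S.Eq.sym (α-U i j))) (α-mono edge)

      trans : ∀ i k j → a i k · α (Walk U k j) ≤ α (Walk U i j)
      trans i k j =
        S.trans (S.·-mono (S.reflexive (S.Eq.sym (α-U i k))) S.refl)
          (S.trans (S.reflexive (S.Eq.sym (α-· _ _)))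
            (α-mono λ { (u , v , u∈ , v∈ , refl) → u∈ ∷ v∈ }))

------------------------------------------------------------------------
-- Nullability as a Galois insertion

boolSemilattice : BoundedJoinSemilattice 0ℓ 0ℓ 0ℓ
boolSemilattice = record
  { Carrier = Bool ; _≈_ = _≡_ ; _≤_ = Bool._≤_ ; _∨_ = _∨_ ; ⊥ = false
  ; isBoundedJoinSemilattice = record
    { isJoinSemilattice = record
      { isPartialOrder = Bool.≤-isPartialOrder
      ; supremum = λ
        { false y → Bool.≤-minimum y , b≤b , λ _ _ q → q
        ; true  y → b≤b , Bool.≤-maximum y , λ _ p _ → p } }
    ; minimum = Bool.≤-minimum } }

∧-mono : Monotonic₂ Bool._≤_ Bool._≤_ Bool._≤_ _∧_
∧-mono f≤t         q = Bool.≤-minimum _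
∧-mono (b≤b {false}) q = b≤b
∧-mono (b≤b {true})  q = q

boolAlgebra : FiniteAlgebra
boolAlgebra = record
  { semilattice = boolSemilattice
  ; finite      = 2 , ↔-sym Fin.2↔Bool
  ; _·_         = _∧_
  ; ·-mono      = ∧-mono
  }

T⇒≤ : ∀ {x y} → (T x → T y) → x Bool.≤ y
T⇒≤ {false}        f = Bool.≤-minimum _
T⇒≤ {true} {true}  f = b≤b
T⇒≤ {true} {false} f = ⊥-elim (f _)

≤⇒T : ∀ {x y} → x Bool.≤ y → T x → T y
≤⇒T b≤b t = t

T-injective : ∀ {x y} → (T x → T y) → (T y → T x) → x ≡ y
T-injective f g = Bool.≤-antisym (T⇒≤ f) (T⇒≤ g)

-- A language is nullable when it contains the empty word.  The truth value of
-- nullability is the abstraction map of a Galois insertion into Bool.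
module Nullability (em : ExcludedMiddle 0ℓ) (A : Set) where

  nullable : Lang A → Bool
  nullable U = ⌊ em {U []} ⌋

  nullable⁺ : ∀ {U : Lang A} → U [] → T (nullable U)
  nullable⁺ = fromWitness

  nullable⁻ : ∀ {U : Lang A} → T (nullable U) → U []
  nullable⁻ = toWitness

  insertion : GaloisInsertion (BoundedJoinSemilattice.poset boolSemilattice)
                              (Lang-poset A)
  insertion = record
    { α      = nullable
    ; γ      = λ b w → w ≡ [] → T b
    ; α-mono = λ {U} {V} U⊆V → T⇒≤ (λ t → nullable⁺ {V} (U⊆V (nullable⁻ {U} t)))
    ; γ-mono = λ b≤c f w≡[] → ≤⇒T b≤c (f w≡[])
    ; α∘γ    = λ b → T-injective
        (λ t → nullable⁻ {λ w → w ≡ [] → T b} t refl)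
        (λ t → nullable⁺ {λ w → w ≡ [] → T b} (λ _ → t))
    ; γ∘α    = λ U → λ { u∈ refl → nullable⁺ {U} u∈ }
    }

  nullable-· : ∀ U V → nullable (U ·ᴸ V) ≡ nullable U ∧ nullable V
  nullable-· U V = T-injective
    (λ t → case nullable⁻ {U ·ᴸ V} t of λ
      { ([] , [] , u∈ , v∈ , refl) →
          Equivalence.from Bool.T-∧ (nullable⁺ {U} u∈ , nullable⁺ {V} v∈) })
    (λ t → let p , q = Equivalence.to Bool.T-∧ t in
      nullable⁺ {U ·ᴸ V} ([] , [] , nullable⁻ {U} p , nullable⁻ {V} q , refl))

------------------------------------------------------------------------
-- Prefixes and infinite products of words

module _ {A : Set} where

  private variable
    a b : A
    u v : List A
    w x y : Word≤ω A

  ∷-injectiveʷ : (a ∷ u) ++ʷ x ≈ʷ (b ∷ v) ++ʷ y → a ≡ b × u ++ʷ x ≈ʷ v ++ʷ y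
  ∷-injectiveʷ {x = fin _} {y = fin _} (fin p) =
    let q , r = List.∷-injective p in q , fin r
  ∷-injectiveʷ {x = inf _} {y = inf _} (inf p) = p 0 , inf (λ n → p (suc n))

  ∷-congʷ : u ++ʷ x ≈ʷ v ++ʷ y → (a ∷ u) ++ʷ x ≈ʷ (a ∷ v) ++ʷ y
  ∷-congʷ {x = fin _} {y = fin _} (fin p) = fin (cong (_ ∷_) p)
  ∷-congʷ {x = inf _} {y = inf _} (inf p) =
    inf λ { zero → refl ; (suc n) → p n }

  ++ʷ-identityˡ : ∀ (x : Word≤ω A) → [] ++ʷ x ≈ʷ x
  ++ʷ-identityˡ (fin u) = ≈ʷ-refl
  ++ʷ-identityˡ (inf f) = inf λ _ → refl

  ++ʷ-cong : ∀ (u : List A) → x ≈ʷ y → u ++ʷ x ≈ʷ u ++ʷ y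
  ++ʷ-cong []      p =
    ≈ʷ-trans (++ʷ-identityˡ _) (≈ʷ-trans p (≈ʷ-sym (++ʷ-identityˡ _)))
  ++ʷ-cong (a ∷ u) p = ∷-congʷ (++ʷ-cong u p)

  ++ʷ-cancelˡ : ∀ (u : List A) → u ++ʷ x ≈ʷ u ++ʷ y → x ≈ʷ y
  ++ʷ-cancelˡ []      p =
    ≈ʷ-trans (≈ʷ-sym (++ʷ-identityˡ _)) (≈ʷ-trans p (++ʷ-identityˡ _))
  ++ʷ-cancelˡ (a ∷ u) p = ++ʷ-cancelˡ u (proj₂ (∷-injectiveʷ p))

  ++ʷ-assoc : ∀ (u v : List A) x → (u ++ v) ++ʷ x ≈ʷ u ++ʷ (v ++ʷ x)
  ++ʷ-assoc []      v x = ≈ʷ-sym (++ʷ-identityˡ _)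
  ++ʷ-assoc (a ∷ u) v (fin x) = fin (cong (a ∷_) (List.++-assoc u v x))
  ++ʷ-assoc (a ∷ u) v (inf x) with ++ʷ-assoc u v (inf x)
  ... | inf p = inf λ { zero → refl ; (suc n) → p n }

  -- Of two prefixes of the same word, the shorter is a prefix of the longer.
  ≼-comparable : ∀ (u v : List A) → length v ℕ.≤ length u →
    u ++ʷ x ≈ʷ v ++ʷ y → v ≼ fin u
  ≼-comparable u       []      _        _ = fin u , ≈ʷ-refl
  ≼-comparable (a ∷ u) (b ∷ v) (s≤s le) p with ∷-injectiveʷ p
  ... | refl , q with ≼-comparable u v le q
  ...   | fin z , fin r = fin z , fin (cong (a ∷_) r)

  ≼[]⇒≡[] : u ≼ fin [] → u ≡ []
  ≼[]⇒≡[] {[]}    _           = refl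
  ≼[]⇒≡[] {_ ∷ _} (fin _ , fin ())

  -- Splitting off the first factor of an infinite product.
  IsProductOf-uncons : ∀ {u : ℕ → List A} → w IsProductOf u →
    ∃ λ x → w ≈ʷ u 0 ++ʷ x × x IsProductOf (u ∘ suc)
  IsProductOf-uncons {w} {u} (below , least) with below 1
  ... | x , w≈ = x , w≈′ , below′ , least′
    where
    w≈′ : w ≈ʷ u 0 ++ʷ x
    w≈′ = subst (λ v → w ≈ʷ v ++ʷ x) (List.++-identityʳ (u 0)) w≈

    below′ : ∀ n → concat (applyUpTo (u ∘ suc) n) ≼ x
    below′ n with below (suc n)
    ... | y , eq = y , ++ʷ-cancelˡ (u 0)
      (≈ʷ-trans (≈ʷ-sym w≈′) (≈ʷ-trans eq (++ʷ-assoc (u 0) _ y)))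

    least′ : ∀ v → v ≼ x → ∃ λ n → v ≼ fin (concat (applyUpTo (u ∘ suc) n))
    least′ v (y , x≈) with least (u 0 ++ v)
      (y , ≈ʷ-trans w≈′ (≈ʷ-trans (++ʷ-cong (u 0) x≈) (≈ʷ-sym (++ʷ-assoc (u 0) v y))))
    ... | suc n , z , eq = n , z , ++ʷ-cancelˡ (u 0)
      (≈ʷ-trans eq (++ʷ-assoc (u 0) v z))
    -- A prefix of the empty product is empty, so the bound 0 still works.
    ... | zero , p with List.++-conicalʳ (u 0) v (≼[]⇒≡[] p)
    ...   | refl = 0 , fin [] , ≈ʷ-refl

  unfold-prefix : ∀ {x : ℕ → Word≤ω A} {u : ℕ → List A} →
    (∀ n → x n ≈ʷ u n ++ʷ x (suc n)) →
    ∀ n → x 0 ≈ʷ concat (applyUpTo u n) ++ʷ x n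
  unfold-prefix unfold zero    = ≈ʷ-sym (++ʷ-identityˡ _)
  unfold-prefix {x} {u} unfold (suc n) = ≈ʷ-trans (unfold 0)
    (≈ʷ-trans (++ʷ-cong (u 0) (unfold-prefix (unfold ∘ suc) n))
      (≈ʷ-sym (++ʷ-assoc (u 0) _ _)))

  length-concat : ∀ {u : ℕ → List A} → (∀ n → u n ≢ []) →
    ∀ n → n ℕ.≤ length (concat (applyUpTo u n))
  length-concat u≢[] zero    = z≤n
  length-concat {u} u≢[] (suc n) with u 0 | u≢[] 0
  ... | []    | ≢ = ⊥-elim (≢ refl)
  ... | a ∷ v | _ = s≤s (ℕ.≤-trans (length-concat (u≢[] ∘ suc) n)
    (subst (length c ℕ.≤_) (≡.sym (List.length-++ v)) (ℕ.m≤n+m _ (length v))))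
    where c = concat (applyUpTo (u ∘ suc) n)

  -- If all factors are nonempty, the finite products get arbitrarily long, so
  -- that every prefix of the word is a prefix of one of them.
  IsProductOf-intro : ∀ {x : ℕ → Word≤ω A} {u : ℕ → List A} →
    (∀ n → x n ≈ʷ u n ++ʷ x (suc n)) → (∀ n → u n ≢ []) → x 0 IsProductOf u
  IsProductOf-intro {x} {u} unfold u≢[] =
    (λ n → x n , unfold-prefix unfold n) ,
    (λ v (y , eq) → length v , ≼-comparable _ v (length-concat u≢[] (length v))
      (≈ʷ-trans (≈ʷ-sym (unfold-prefix unfold (length v))) eq))

------------------------------------------------------------------------
-- Lassos

module _ {A I : Set} (U : I → I → Lang A) where

  -- The words that can be read by returning to i forever.  A nullable cycle
  -- at i can be repeated without reading anything, so it allows every word.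
  Loop : I → Lang≤ω A
  mem  (Loop i) w = Walk U i i [] ⊎ w ∈ω (Walk U i i ^ωᴸ)
  resp (Loop i) p (inj₁ ε∈) = inj₁ ε∈
  resp (Loop i) p (inj₂ w∈) = inj₂ (resp (Walk U i i ^ωᴸ) p w∈)

  -- The words read by walking from i to some j and then looping at j.
  Lasso : I → Lang≤ω A
  Lasso i = ⋃ω λ j → Walk U i j ·ω Loop j

  Loop-unfold : ∀ {i} → Loop i ⊆ω (Walk U i i ·ω Loop i)
  Loop-unfold (inj₁ ε∈) = [] , _ , ε∈ , inj₁ ε∈ , ≈ʷ-sym (++ʷ-identityˡ _)
  Loop-unfold (inj₂ (u , u∈ , w≈)) with IsProductOf-uncons w≈
  ... | x , eq , x≈ = u 0 , x , u∈ 0 , inj₂ (u ∘ suc , u∈ ∘ suc , x≈) , eq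

  Lasso-unfold : ∀ {i} → Lasso i ⊆ω ⋃ω (λ k → U i k ·ω Lasso k)
  Lasso-unfold (j , u , x , edge u∈ , x∈ , eq) =
    j , u , x , u∈ , (j , Loop-unfold x∈) , eq
  Lasso-unfold (j , _ , x , (_∷_ {k} {u = u} {v} u∈ v∈) , x∈ , eq) =
    k , u , v ++ʷ x , u∈ , (j , v , x , v∈ , x∈ , ≈ʷ-refl) ,
    ≈ʷ-trans eq (++ʷ-assoc u v x)

  Lasso-fold : ∀ {i} → ⋃ω (λ k → U i k ·ω Lasso k) ⊆ω Lasso i
  Lasso-fold (k , u , y , u∈ , (j , v , x , v∈ , x∈ , y≈) , eq) =
    j , u ++ v , x , u∈ ∷ v∈ , x∈ ,
    ≈ʷ-trans eq (≈ʷ-trans (++ʷ-cong u y≈) (≈ʷ-sym (++ʷ-assoc u v x)))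

-- The value i occurs infinitely often in the sequence s.
Recurrent : {I : Set} → (ℕ → I) → I → Set
Recurrent s i = ∀ n → ∃ λ m → n ℕ.< m × s m ≡ i

module _ (em : ExcludedMiddle 0ℓ) where

  -- Either some value recurs, or from some time on the listed values are
  -- avoided.
  recurrent⊎bounded : ∀ {I : Set} (s : ℕ → I) (is : List I) →
    ∃ (Recurrent s) ⊎ (∃ λ N → ∀ n → N ℕ.< n → ¬ s n ∈ is)
  recurrent⊎bounded s [] = inj₂ (0 , λ _ _ ())
  recurrent⊎bounded s (i ∷ is) with recurrent⊎bounded s is
  ... | inj₁ rec = inj₁ rec
  ... | inj₂ (N , s∉is)
    with em {∃ λ N → ∀ n → N ℕ.< n → s n ≢ i}
  ...   | yes (N′ , s≢i) = inj₂ (N ℕ.⊔ N′ , λ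
    { n lt (here eq)  → s≢i n (ℕ.≤-<-trans (ℕ.m≤n⊔m N N′) lt) eq
    ; n lt (there i∈) → s∉is n (ℕ.≤-<-trans (ℕ.m≤m⊔n N N′) lt) i∈ })
  ...   | no unbounded = inj₁ (i , λ n →
    decidable-stable em λ none → unbounded
      (n , λ m n<m eq → none (m , n<m , eq)))

  recurrent : ∀ {I : Set} → Enumeration I → (s : ℕ → I) → ∃ (Recurrent s)
  recurrent E s with recurrent⊎bounded s (Enumeration.list E)
  ... | inj₁ rec        = rec
  ... | inj₂ (N , s∉is) =
    ⊥-elim (s∉is (suc N) ℕ.≤-refl (Enumeration.complete E (s (suc N))))

  module _ {A I : Set} {U : I → I → Lang A}
      {s : ℕ → I} {x : ℕ → Word≤ω A} {h : ℕ → List A}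
      (label : ∀ n → U (s n) (s (suc n)) (h n))
      (unfold : ∀ n → x n ≈ʷ h n ++ʷ x (suc n)) where

    -- What is read between the times m and n along the path.
    segment : ∀ {m n} → suc m ≤‴ n →
      ∃ λ u → Walk U (s m) (s n) u × x m ≈ʷ u ++ʷ x n
    segment {m} ≤‴-refl = h m , edge (label m) , unfold m
    segment {m} {n} (≤‴-step lt) with segment lt
    ... | u , u∈ , eq = h m ++ u , label m ∷ u∈ ,
      ≈ʷ-trans (unfold m)
        (≈ʷ-trans (++ʷ-cong (h m) eq) (≈ʷ-sym (++ʷ-assoc (h m) u (x n))))

    run∈Lasso : Enumeration I → x 0 ∈ω Lasso U (s 0)
    run∈Lasso E = i , u , x (time 0) , walk , loop , eq
      where
      i   = proj₁ (recurrent E s)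
      rec = proj₂ (recurrent E s)

      -- A strictly increasing sequence of visits to i.
      time : ℕ → ℕ
      time zero    = proj₁ (rec 0)
      time (suc n) = proj₁ (rec (time n))

      at-i : ∀ n → s (time n) ≡ i
      at-i zero    = proj₂ (proj₂ (rec 0))
      at-i (suc n) = proj₂ (proj₂ (rec (time n)))

      first : ∃ λ u → Walk U (s 0) i u × x 0 ≈ʷ u ++ʷ x (time 0)
      first = subst (λ j → ∃ λ u → Walk U (s 0) j u × x 0 ≈ʷ u ++ʷ x (time 0))
        (at-i 0) (segment (ℕ.≤⇒≤‴ (proj₁ (proj₂ (rec 0)))))

      u    = proj₁ first
      walk = proj₁ (proj₂ first)
      eq   = proj₂ (proj₂ first)

      lap : ∀ n → ∃ λ u → Walk U i i u × x (time n) ≈ʷ u ++ʷ x (time (suc n))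
      lap n = subst₂
        (λ j k → ∃ λ u → Walk U j k u × x (time n) ≈ʷ u ++ʷ x (time (suc n)))
        (at-i n) (at-i (suc n))
        (segment (ℕ.≤⇒≤‴ (proj₁ (proj₂ (rec (time n))))))

      loop : x (time 0) ∈ω Loop U i
      loop with em {Walk U i i []}
      ... | yes ε∈ = inj₁ ε∈
      ... | no  ε∉ = inj₂
        ( (λ n → proj₁ (lap n))
        , (λ n → proj₁ (proj₂ (lap n)))
        , IsProductOf-intro (λ n → proj₂ (proj₂ (lap n)))
            (λ n ≡[] → ε∉ (subst (Walk U i i) ≡[] (proj₁ (proj₂ (lap n))))) )

------------------------------------------------------------------------
-- The infinitary effect typing consists of lassos

module _ (P : Program) {A : Set} (M : MethodTyping P A) where
  open Program P

  -- The language preceding ε in the call expression of δ.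
  callLabel : Sig → Sig → Lang A
  callLabel δ ε = fromMaybe ∅ (proj₂ (M δ) ε)

  Lasso-isSolution : IsSolution P M (Lasso callLabel)
  Lasso-isSolution δ = Lasso-unfold callLabel , Lasso-fold callLabel

  effectTyping≐Lasso : ExcludedMiddle 0ℓ → ∀ {η} →
    IsInfinitaryEffectTyping P M η → ∀ δ → η δ ≐ω Lasso callLabel δ
  effectTyping≐Lasso em {η} (isSolution , greatest) δ =
    η⊆Lasso , greatest (Lasso callLabel) Lasso-isSolution δ
    where
    -- A word of η unfolds forever, as unfolding is the greatest solution.
    η⊆Lasso : η δ ⊆ω Lasso callLabel δ
    η⊆Lasso w∈ = resp (Lasso callLabel δ) (≈ʷ-sym start′)
      (subst (λ ε → words 0 ∈ω Lasso callLabel ε) start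
        (run∈Lasso em step step′ (signatures P)))
      where
      open Unfolding
        (proj₂ (infinitaryEffectTyping-correct P M) η isSolution δ w∈)

------------------------------------------------------------------------
-- Solving the abstract equation system

-- The computation uses only the algebra, never the maps α and γ.
module Solve (B : FiniteBüchiAlgebra) where
  open FiniteBüchiAlgebra B

  *-algebra : FiniteAlgebra
  *-algebra = record
    { semilattice = M* ; finite = M*-finite ; _·_ = _·_ ; ·-mono = ·-mono }

  -- In a Büchi abstraction this says that the empty word is in γ* a.
  Inflationary : M*.Carrier → Set
  Inflationary a = ∀ b → b M*.≤ (a · b)

  inflationary? : ∀ a → Dec (Inflationary a)
  inflationary? a = map′
    (λ all b →
      let x≤ax , b≈x = All.lookupAny all (elements-complete M*-finite b) in
      M*.trans (M*.reflexive b≈x)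
        (M*.trans x≤ax (·-mono M*.refl (M*.reflexive (M*.Eq.sym b≈x)))))
    (λ infl → All.universal infl _)
    (All.all? (λ b → FiniteJoin._≤?_ M* M*-finite b (a · b)) (elements M*-finite))

  -- The abstractions of an edge label in M* and in Bool.  An undefined entry
  -- stands for the empty language.
  *-label : Maybe M*.Carrier → M*.Carrier
  *-label = fromMaybe M*.⊥

  null-label : Maybe M*.Carrier → Bool
  null-label nothing  = false
  null-label (just a) = ⌊ inflationary? a ⌋

  ⊤ω : M≤ω.Carrier
  ⊤ω = FiniteJoin.⊤ M≤ω M≤ω-finite

  module _ {I : Set} (E : Enumeration I) (a : I → I → Maybe M*.Carrier) where

    -- Abstractions of Walk, of the nullability of its diagonal, of Loop and of
    -- Lasso.
    walk : I → I → M*.Carrier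
    walk = Closure.plus E *-algebra (λ i j → *-label (a i j))

    hasNullLoop : I → Bool
    hasNullLoop i =
      Closure.plus E boolAlgebra (λ i j → null-label (a i j)) i i

    loop : I → M≤ω.Carrier
    loop i = if hasNullLoop i then ⊤ω else walk i i ^ω

    lasso : I → M≤ω.Carrier
    lasso i = FiniteJoin.⋁ M≤ω (Enumeration.list E) (λ j → walk i j ⊙ loop j)

module Correctness (em : ExcludedMiddle 0ℓ) {A : Set} {B : FiniteBüchiAlgebra}
    (𝓜 : BüchiAbstraction A B) where
  open FiniteBüchiAlgebra B
  open BüchiAbstraction 𝓜
  open Solve B
  open Nullability em A
  private
    module α* = Adjunction insertion*
    module α≤ω = Adjunction insertion≤ω

  -- The language denoted by an entry of an abstract expression.
  concrete : Maybe M*.Carrier → Lang A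
  concrete a = fromMaybe ∅ (Maybe.map γ* a)

  α*-concrete : ∀ a → α* (concrete a) M*.≈ *-label a
  α*-concrete (just a) = α*∘γ* a
  α*-concrete nothing  = M*.antisym (α*.α-adjoint λ ()) (M*.minimum _)

  -- The image under α* of the language containing just the empty word is a unit
  -- for multiplication; b ≤ a · b for this b gives the converse direction.
  ε∈γ⇔inflationary : ∀ a → (γ* a [] → Inflationary a) × (Inflationary a → γ* a [])
  ε∈γ⇔inflationary a = to , from
    where
    ε : Lang A
    ε w = w ≡ []

    to : γ* a [] → Inflationary a
    to ε∈ b = M*.trans (M*.reflexive (M*.Eq.sym (α*∘γ* b)))
      (M*.trans (α*-mono λ {w} w∈ → [] , w , ε∈ , w∈ , refl)
        (M*.trans (M*.reflexive (α-· (γ* a) (γ* b)))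
          (·-mono (M*.reflexive (α*∘γ* a)) (M*.reflexive (α*∘γ* b)))))

    from : Inflationary a → γ* a []
    from infl = α*.γ-adjoint {ε} (M*.trans (infl (α* ε))
      (M*.trans (·-mono (M*.reflexive (M*.Eq.sym (α*∘γ* a))) M*.refl)
        (M*.trans (M*.reflexive (M*.Eq.sym (α-· (γ* a) ε)))
          (α*.α-adjoint λ { (u , v , u∈ , refl , refl) →
            subst (γ* a) (≡.sym (List.++-identityʳ u)) u∈ })))) refl

  nullable-concrete : ∀ a → nullable (concrete a) ≡ null-label a
  nullable-concrete (just a) = T-injective
    (λ t → fromWitness (proj₁ (ε∈γ⇔inflationary a) (nullable⁻ {γ* a} t)))
    (λ t → nullable⁺ {γ* a} (proj₂ (ε∈γ⇔inflationary a) (toWitness t)))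
  nullable-concrete nothing = T-injective (nullable⁻ {∅}) λ ()

  α≤ω-cong : ∀ {V W} → V ≐ω W → α≤ω V M≤ω.≈ α≤ω W
  α≤ω-cong {V} {W} (V⊆W , W⊆V) =
    M≤ω.antisym (α≤ω-mono {V} {W} V⊆W) (α≤ω-mono {W} {V} W⊆V)

  ⊙-cong : ∀ {a b u v} → a M*.≈ b → u M≤ω.≈ v → (a ⊙ u) M≤ω.≈ (b ⊙ v)
  ⊙-cong a≈b u≈v = M≤ω.antisym
    (⊙-mono (M*.reflexive a≈b) (M≤ω.reflexive u≈v))
    (⊙-mono (M*.reflexive (M*.Eq.sym a≈b)) (M≤ω.reflexive (M≤ω.Eq.sym u≈v)))

  ^ω-cong : ∀ {a b} → a M*.≈ b → (a ^ω) M≤ω.≈ (b ^ω)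
  ^ω-cong a≈b = M≤ω.antisym
    (^ω-mono (M*.reflexive a≈b)) (^ω-mono (M*.reflexive (M*.Eq.sym a≈b)))

  α≤ω-full : ∀ {V} → (∀ w → w ∈ω V) → α≤ω V M≤ω.≈ ⊤ω
  α≤ω-full {V} full = M≤ω.antisym (FiniteJoin.≤⊤ M≤ω M≤ω-finite _)
    (M≤ω.trans (M≤ω.reflexive (M≤ω.Eq.sym (α≤ω∘γ≤ω ⊤ω)))
      (α≤ω-mono {γ≤ω ⊤ω} {V} (λ {w} _ → full w)))

  α≤ω-⋃ : ∀ {I : Set} (E : Enumeration I) (V : I → Lang≤ω A) {x} →
    (∀ i → α≤ω (V i) M≤ω.≈ x i) →
    α≤ω (⋃ω V) M≤ω.≈ FiniteJoin.⋁ M≤ω (Enumeration.list E) x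
  α≤ω-⋃ E V {x} V≈x = M≤ω.antisym
    (α≤ω.α-adjoint {⋃ω V} λ { (i , w∈) →
      α≤ω.γ-adjoint {V i} (M≤ω.trans (M≤ω.reflexive (V≈x i))
        (⋁-upper x (Enumeration.complete E i))) w∈ })
    (⋁-least (Enumeration.list E) λ i → M≤ω.trans (M≤ω.reflexive (M≤ω.Eq.sym (V≈x i)))
      (α≤ω-mono {V i} {⋃ω V} λ w∈ → i , w∈))
    where open FiniteJoin M≤ω

  module _ {I : Set} (E : Enumeration I) (a : I → I → Maybe M*.Carrier) where

    U : I → I → Lang A
    U i j = concrete (a i j)

    α*-walk : ∀ i j → α* (Walk U i j) M*.≈ walk E a i j
    α*-walk = α-Walk E *-algebra insertion* α-· U _ λ i j → α*-concrete (a i j)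

    nullable-walk : ∀ i → nullable (Walk U i i) ≡ hasNullLoop E a i
    nullable-walk i = α-Walk E boolAlgebra insertion nullable-· U _
      (λ i j → nullable-concrete (a i j)) i i

    α≤ω-loop : ∀ i → α≤ω (Loop U i) M≤ω.≈ loop E a i
    α≤ω-loop i with em {Walk U i i []} | hasNullLoop E a i | nullable-walk i
    ... | yes ε∈ | true  | _ = α≤ω-full {Loop U i} (λ w → inj₁ ε∈)
    ... | no  ε∉ | false | _ = M≤ω.Eq.trans
      (α≤ω-cong {Loop U i} {Walk U i i ^ωᴸ}
        ((λ { (inj₁ ε∈) → ⊥-elim (ε∉ ε∈) ; (inj₂ w∈) → w∈ }) , inj₂))
      (M≤ω.Eq.trans (α-ω (Walk U i i)) (^ω-cong (α*-walk i i)))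

    α≤ω-lasso : ∀ i → α≤ω (Lasso U i) M≤ω.≈ lasso E a i
    α≤ω-lasso i = α≤ω-⋃ E (λ j → Walk U i j ·ω Loop U j) λ j →
      M≤ω.Eq.trans (α-⊙ (Walk U i j) (Loop U j))
        (⊙-cong (α*-walk i j) (α≤ω-loop j))

theorem5p8 : Σ[ solve ∈ ((P : Program) (B : FiniteBüchiAlgebra) → BüchiMethodTyping P B → Program.Sig P → FiniteBüchiAlgebra.M≤ω.Carrier B) ]
    (ExcludedMiddle 0ℓ →
    (A : Set) → IsFiniteSet A →
    (P : Program) (B : FiniteBüchiAlgebra) (𝓜 : BüchiAbstraction A B) →
    (𝔄 : Lang≤ω A) → BüchiAbstraction.Faithful 𝓜 𝔄 →
    (M : BüchiMethodTyping P B) →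
    (η : Program.Sig P → Lang≤ω A) →
    IsInfinitaryEffectTyping P (concretize P 𝓜 M) η →
    (δ : Program.Sig P) →
    FiniteBüchiAlgebra.M≤ω._≈_ B (solve P B M δ) (BüchiAbstraction.α≤ω 𝓜 (η δ)))
theorem5p8 = solve , correct
  where
  calls : ∀ {P} B → BüchiMethodTyping P B → Program.Sig P → Program.Sig P →
    Maybe (FiniteBüchiAlgebra.M*.Carrier B)
  calls B M δ = proj₂ (BüchiMethodTyping.typing M δ)

  solve : (P : Program) (B : FiniteBüchiAlgebra) → BüchiMethodTyping P B →
    Program.Sig P → FiniteBüchiAlgebra.M≤ω.Carrier B
  solve P B M = Solve.lasso B (signatures P) (calls B M)

  correct : ExcludedMiddle 0ℓ → (A : Set) → IsFiniteSet A →
    (P : Program) (B : FiniteBüchiAlgebra) (𝓜 : BüchiAbstraction A B) →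
    (𝔄 : Lang≤ω A) → BüchiAbstraction.Faithful 𝓜 𝔄 →
    (M : BüchiMethodTyping P B) (η : Program.Sig P → Lang≤ω A) →
    IsInfinitaryEffectTyping P (concretize P 𝓜 M) η → ∀ δ →
    FiniteBüchiAlgebra.M≤ω._≈_ B (solve P B M δ) (BüchiAbstraction.α≤ω 𝓜 (η δ))
  correct em A _ P B 𝓜 _ _ M η typing δ = M≤ω.Eq.sym
    (M≤ω.Eq.trans
      (α≤ω-cong {η δ} {Lasso (callLabel P (concretize P 𝓜 M)) δ}
        (effectTyping≐Lasso P (concretize P 𝓜 M) em {η} typing δ))
      (α≤ω-lasso (signatures P) (calls B M) δ))
    where
    open FiniteBüchiAlgebra B using (module M≤ω)
    open Correctness em 𝓜
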